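{- For every $n\ge1$, the number of signed permutations in $B_n$ with no peaks equals $2^{2n-1}$; that is, $\#P_B(\emptyset,n)=2^{2n-1}$.
   Context: $B_n$ is the set of signed permutations $\pi=\pi_1\cdots\pi_n$: words with each $\pi_i\in\{ -n,\dots,-1,1,\dots,n\}$ and $\{|\pi_1|,\dots,|\pi_n|\}=\{1,\dots,n\}$. An index $i\in\{2,\dots,n-1\}$ is a peak of $\pi$ if $\pi_{i-1}<\pi_i>\pi_{i+1}$, and $P_B(S,n)$ is the set of $\pi\in B_n$ whose set of peaks equals $S$. -}

module Defs where

open import Data.Nat using (ℕ; zero; suc; _≤ᵇ_; _≡ᵇ_)
open import Data.Integer as ℤ using (ℤ; ∣_∣; _<_)
open import Data.Integer.Properties using (_<?_)
open import Data.Bool using (Bool; true; false; _∧_; _∨_; not; T)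
open import Data.List using (List; []; _∷_; length; map; upTo)
open import Data.Bool.ListAction using (any; all)
open import Data.Product using (Σ; _×_; proj₁)
open import Relation.Nullary.Decidable using (⌊_⌋)
open import Relation.Binary.PropositionalEquality using (_≡_)

-- A word π = π₁ ⋯ πₙ over ℤ is represented as a list of integers.

-- each letter lies in {-n,…,-1,1,…,n}
letterOK : ℕ → ℤ → Bool
letterOK n x = not (∣ x ∣ ≡ᵇ 0) ∧ (∣ x ∣ ≤ᵇ n)

-- {|π₁|,…,|πₙ|} = {1,…,n}: every k ∈ {1,…,n} occurs as some |πᵢ|
-- (together with each |πᵢ| ∈ {1,…,n} this gives set equality)
coversAll : ℕ → List ℤ → Bool
coversAll n w = all (λ k → any (λ x → ∣ x ∣ ≡ᵇ suc k) w) (upTo n)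

-- Boolean test for membership in B_n
isSignedPerm : ℕ → List ℤ → Bool
isSignedPerm n w = (length w ≡ᵇ n) ∧ all (letterOK n) w ∧ coversAll n w

-- B_n as a set (proof-irrelevant membership via T)
B : ℕ → Set
B n = Σ (List ℤ) (λ w → T (isSignedPerm n w))

-- true iff the word has a peak, i.e. some consecutive triple a b c with a < b > c
-- (the middle position of a consecutive triple is exactly an index in {2,…,n-1})
hasPeak : List ℤ → Bool
hasPeak (a ∷ b ∷ c ∷ w) = (⌊ a <? b ⌋ ∧ ⌊ c <? b ⌋) ∨ hasPeak (b ∷ c ∷ w)
hasPeak _ = false

-- P_B(∅, n): signed permutations whose set of peaks is empty
PB∅ : ℕ → Set
PB∅ n = Σ (B n) (λ π → T (not (hasPeak (proj₁ π))))

-- A peakless word with distinct letters is valley-shaped: it decreases to its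
-- minimum and then increases.  In a signed permutation of size n+1 the letter of
-- largest absolute value is ±(n+1).  The letter +(n+1) is the maximum, so it is the
-- first or the last letter; the letter -(n+1) is the minimum, so it is the valley,
-- and the valley of the remaining word sits immediately to its left or right.
-- Removing ±(n+1) therefore identifies P_B(∅, n+1) with
-- {+,-} × {left, right} × P_B(∅, n) for n ≥ 1, and P_B(∅, 1) = {1, -1}, whence
-- #P_B(∅, n) = 2 · 4^(n-1) = 2^(2n-1).
module Submission where

open import Defs
open import Data.Nat using (ℕ; suc; _*_; _∸_; _^_)
open import Data.Fin using (Fin)
open import Function.Bundles using (_↔_)

open import Level using (_⊔_)
open import Function.Base using (_∘_)
open import Function.Bundles using (mk↔ₛ′; _⇔_; mk⇔; Equivalence)
open import Function.Properties.Inverse using (↔-trans; ↔-sym)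
open import Data.Empty using (⊥-elim)
open import Data.Unit.Polymorphic using (⊤)
open import Data.Bool using (T; _∧_; not; if_then_else_)
open import Data.Bool.Properties using (T-∧; T-irrelevant)
open import Data.Bool.ListAction using (all; any)
open import Data.Product as Product using (_×_; _,_; proj₁; proj₂; ∃-syntax; ∃₂)
open import Data.Product.Function.NonDependent.Propositional using (_×-↔_)
open import Data.Sum as Sum using (_⊎_; inj₁; inj₂)
open import Data.Nat as ℕ using (zero; _≤_; _<_; z≤n; s≤s; NonZero)
import Data.Nat.Properties as ℕP
open import Data.Integer as ℤ using (ℤ; ∣_∣; +_; -[1+_]; +<+; -<+; -<-)
import Data.Integer.Properties as ℤP
open import Data.Sign as Sign using (Sign)
open import Data.Fin.Patterns using (0F; 1F)
open import Data.Fin.Properties using (*↔×)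
open import Data.List using (List; []; _∷_; _++_; [_]; _∷ʳ_; length; upTo; filter)
open import Data.List.Properties
  using (∷-injectiveˡ; ∷-injectiveʳ; ++-assoc; ++-identityʳ; filter-++; filter-all; filter-reject)
open import Data.List.Membership.Propositional using (_∈_; _∉_; find; lose)
open import Data.List.Membership.Propositional.Properties using (∈-insert; ∈-∃++; ∈-upTo⁺; ∈-upTo⁻)
open import Data.List.Relation.Unary.All as All using (All; []; _∷_)
open import Data.List.Relation.Unary.All.Properties as All using (all⁺; all⁻)
open import Data.List.Relation.Unary.Any using (here; there)
open import Data.List.Relation.Unary.Any.Properties using (any⁺; any⁻)
open import Data.List.Relation.Unary.Linked using (Linked; []; [-]; _∷_)
open import Data.List.Relation.Binary.Permutation.Propositional using (_↭_; ↭-sym)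
open import Data.List.Relation.Binary.Permutation.Propositional.Properties
  using (∈-resp-↭; ↭-length; shift)
open import Relation.Binary.Core using (Rel)
open import Relation.Binary.Definitions using (tri<; tri≈; tri>)
open import Relation.Binary.Structures using (IsStrictTotalOrder)
open import Relation.Binary.PropositionalEquality
  using (_≡_; _≢_; refl; sym; trans; subst; cong; cong₂; module ≡-Reasoning)
open import Relation.Nullary using (¬_; ¬?; yes; no; does; contradiction)
import Relation.Unary as U

module PeaklessWords {a ℓ} {A : Set a} {_<_ : Rel A ℓ}
                     (isSTO : IsStrictTotalOrder _≡_ _<_) where

  open IsStrictTotalOrder isSTO using (_<?_; compare; asym) renaming (trans to <-trans)

  private variable
    x y z : A
    u v w : List A

  ≢∧≯⇒< : x ≢ y → ¬ y < x → x < y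
  ≢∧≯⇒< {x} {y} x≢y y≮x with compare x y
  ... | tri< x<y _ _ = x<y
  ... | tri≈ _ x≡y _ = contradiction x≡y x≢y
  ... | tri> _ _ y<x = contradiction y<x y≮x

  NoPeakAfter : A → List A → Set ℓ
  NoPeakAfter x (y ∷ z ∷ _) = ¬ (x < y × z < y)
  NoPeakAfter x _           = ⊤

  data Peakless : List A → Set (a ⊔ ℓ) where
    []  : Peakless []
    _∷_ : NoPeakAfter x w → Peakless w → Peakless (x ∷ w)

  peakless-∷⁻ : Peakless (x ∷ w) → Peakless w
  peakless-∷⁻ (_ ∷ p) = p

  HeadBelow : A → List A → Set ℓ
  HeadBelow x []      = ⊤
  HeadBelow x (y ∷ _) = y < x

  All⇒HeadBelow : All (_< x) w → HeadBelow x w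
  All⇒HeadBelow []        = _
  All⇒HeadBelow (y<x ∷ _) = y<x

  noPeakAfter-≯ : ¬ x < y → NoPeakAfter x (y ∷ w)
  noPeakAfter-≯ {w = []}    _   = _
  noPeakAfter-≯ {w = _ ∷ _} x≮y = x≮y ∘ proj₁

  noPeakAfter-below : x < y → NoPeakAfter x (y ∷ w) → NoPeakAfter z (y ∷ w)
  noPeakAfter-below {w = []}    _   _  = _
  noPeakAfter-below {w = _ ∷ _} x<y np = λ (_ , w<y) → np (x<y , w<y)

  peakless-∷⁺ : HeadBelow x w → Peakless w → Peakless (x ∷ w)
  peakless-∷⁺ {w = []}        _   p = _ ∷ p
  peakless-∷⁺ {w = _ ∷ []}    _   p = _ ∷ p
  peakless-∷⁺ {w = _ ∷ _ ∷ _} y<x p = (λ (x<y , _) → asym x<y y<x) ∷ p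

  peakless-∷ʳ⁺ : All (_< x) w → Peakless w → Peakless (w ∷ʳ x)
  peakless-∷ʳ⁺ []                     []           = _ ∷ []
  peakless-∷ʳ⁺ (_ ∷ [])               (_ ∷ [])     = _ ∷ _ ∷ []
  peakless-∷ʳ⁺ (_ ∷ b<x ∷ [])         (_ ∷ _ ∷ []) = (λ (_ , x<b) → asym x<b b<x) ∷ _ ∷ _ ∷ []
  peakless-∷ʳ⁺ (_ ∷ w<x@(_ ∷ _ ∷ _)) (np ∷ p)     = np ∷ peakless-∷ʳ⁺ w<x p

  peakless-∷ʳ⁻ : ∀ w → Peakless (w ∷ʳ x) → Peakless w
  peakless-∷ʳ⁻ []              _        = []
  peakless-∷ʳ⁻ (_ ∷ [])        _        = _ ∷ []
  peakless-∷ʳ⁻ (_ ∷ _ ∷ [])    (_ ∷ p)  = _ ∷ peakless-∷ʳ⁻ (_ ∷ []) p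
  peakless-∷ʳ⁻ (_ ∷ _ ∷ _ ∷ w) (np ∷ p) = np ∷ peakless-∷ʳ⁻ (_ ∷ _ ∷ w) p

  max-at-end : ∀ u → Peakless (u ++ x ∷ v) → All (_< x) (u ++ v) → u ≡ [] ⊎ v ≡ []
  max-at-end []                          _        _               = inj₁ refl
  max-at-end {v = []}    (_ ∷ [])        _        _               = inj₂ refl
  max-at-end {v = _ ∷ _} (_ ∷ [])        (np ∷ _) (a<x ∷ b<x ∷ _) = ⊥-elim (np (a<x , b<x))
  max-at-end             (_ ∷ u@(_ ∷ _)) (_ ∷ p)  (_ ∷ u++v<x)    with max-at-end u p u++v<x
  ... | inj₂ v≡[] = inj₂ v≡[]

  peakless-remove-min : ∀ u → Peakless (u ++ x ∷ v) → All (x <_) (u ++ v) → Peakless (u ++ v)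
  peakless-remove-min []                              (_ ∷ p)      _               = p
  peakless-remove-min {v = []}    (_ ∷ [])            _            _               = _ ∷ []
  peakless-remove-min {v = _ ∷ _} (_ ∷ [])            (_ ∷ nx ∷ p) (_ ∷ x<b ∷ _)   =
    noPeakAfter-below x<b nx ∷ p
  peakless-remove-min             (_ ∷ b ∷ [])        (np ∷ p)     (_ ∷ x<b ∷ x<v) =
    noPeakAfter-≯ (λ a<b → np (a<b , x<b)) ∷ peakless-remove-min (b ∷ []) p (x<b ∷ x<v)
  peakless-remove-min             (_ ∷ u@(_ ∷ _ ∷ _)) (np ∷ p)     (_ ∷ x<u++v)    =
    np ∷ peakless-remove-min u p x<u++v

  -- The valley of a word is the last letter of its initial strictly descending run.
  insertBeforeValley : A → List A → List A
  insertBeforeValley x []          = x ∷ []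
  insertBeforeValley x (a ∷ [])    = x ∷ a ∷ []
  insertBeforeValley x (a ∷ b ∷ w) =
    if does (b <? a) then a ∷ insertBeforeValley x (b ∷ w) else x ∷ a ∷ b ∷ w

  insertAfterValley : A → List A → List A
  insertAfterValley x []          = x ∷ []
  insertAfterValley x (a ∷ [])    = a ∷ x ∷ []
  insertAfterValley x (a ∷ b ∷ w) =
    if does (b <? a) then a ∷ insertAfterValley x (b ∷ w) else a ∷ x ∷ b ∷ w

  insertBeforeValley-split : ∀ x w → ∃₂ λ u v → w ≡ u ++ v × insertBeforeValley x w ≡ u ++ x ∷ v
  insertBeforeValley-split x []          = [] , [] , refl , refl
  insertBeforeValley-split x (a ∷ [])    = [] , a ∷ [] , refl , refl
  insertBeforeValley-split x (a ∷ b ∷ w) with b <? a | insertBeforeValley-split x (b ∷ w)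
  ... | yes _ | u , v , w≡ , ins≡ = a ∷ u , v , cong (a ∷_) w≡ , cong (a ∷_) ins≡
  ... | no  _ | _                 = [] , a ∷ b ∷ w , refl , refl

  insertAfterValley-split : ∀ x w → ∃₂ λ u v → w ≡ u ++ v × insertAfterValley x w ≡ u ++ x ∷ v
  insertAfterValley-split x []          = [] , [] , refl , refl
  insertAfterValley-split x (a ∷ [])    = a ∷ [] , [] , refl , refl
  insertAfterValley-split x (a ∷ b ∷ w) with b <? a | insertAfterValley-split x (b ∷ w)
  ... | yes _ | u , v , w≡ , ins≡ = a ∷ u , v , cong (a ∷_) w≡ , cong (a ∷_) ins≡
  ... | no  _ | _                 = a ∷ [] , b ∷ w , refl , refl

  insertBeforeValley-headBelow : y < z → x < z → HeadBelow z (insertBeforeValley x (y ∷ w))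
  insertBeforeValley-headBelow {y} {w = []}    _   x<z = x<z
  insertBeforeValley-headBelow {y} {w = b ∷ w} y<z x<z with b <? y
  ... | yes _ = y<z
  ... | no  _ = x<z

  insertAfterValley-headBelow : y < z → HeadBelow z (insertAfterValley x (y ∷ w))
  insertAfterValley-headBelow {y} {w = []}    y<z = y<z
  insertAfterValley-headBelow {y} {w = b ∷ w} y<z with b <? y
  ... | yes _ = y<z
  ... | no  _ = y<z

  peakless-insertBeforeValley : All (x <_) w → Peakless w → Peakless (insertBeforeValley x w)
  peakless-insertBeforeValley []       []      = _ ∷ []
  peakless-insertBeforeValley (_ ∷ []) p       = _ ∷ p
  peakless-insertBeforeValley {w = a ∷ b ∷ w} (x<a ∷ x<bw) p@(_ ∷ p′)
    with b <? a | peakless-insertBeforeValley x<bw p′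
  ... | yes b<a | ih = peakless-∷⁺ (insertBeforeValley-headBelow {w = w} b<a x<a) ih
  ... | no  b≮a | _  = (b≮a ∘ proj₂) ∷ p

  peakless-insertAfterValley : All (x <_) w → Linked _≢_ w → Peakless w →
                               Peakless (insertAfterValley x w)
  peakless-insertAfterValley []       _ []      = _ ∷ []
  peakless-insertAfterValley (_ ∷ []) _ (_ ∷ p) = _ ∷ _ ∷ p
  peakless-insertAfterValley {x = x} {w = a ∷ b ∷ w} (x<a ∷ x<bw) (a≢b ∷ lk) (np ∷ p)
    with b <? a | peakless-insertAfterValley x<bw lk p
  ... | yes b<a | ih = peakless-∷⁺ (insertAfterValley-headBelow {x = x} {w = w} b<a) ih
  ... | no  b≮a | _  = (λ (a<x , _) → asym x<a a<x)
                     ∷ noPeakAfter-below (≢∧≯⇒< a≢b b≮a) np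
                     ∷ p

  insertBeforeValley≢insertAfterValley : x ∉ w → w ≢ [] → insertBeforeValley x w ≢ insertAfterValley x w
  insertBeforeValley≢insertAfterValley {w = []}     _   w≢[] _  = w≢[] refl
  insertBeforeValley≢insertAfterValley {w = a ∷ []} x∉w _    eq = x∉w (here (∷-injectiveˡ eq))
  insertBeforeValley≢insertAfterValley {w = a ∷ b ∷ w} x∉w _
    with b <? a | insertBeforeValley≢insertAfterValley {w = b ∷ w} (x∉w ∘ there) (λ ())
  ... | yes _ | ih = ih ∘ ∷-injectiveʳ
  ... | no  _ | _  = x∉w ∘ here ∘ ∷-injectiveˡ

  ascent-persists : Linked _≢_ (y ∷ w) → Peakless (x ∷ y ∷ w) → x < y → All (y <_) w
  ascent-persists {w = []}    _          _        _   = []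
  ascent-persists {w = _ ∷ _} (y≢z ∷ lk) (np ∷ p) x<y =
    let y<z = ≢∧≯⇒< y≢z (λ z<y → np (x<y , z<y))
    in y<z ∷ All.map (<-trans y<z) (ascent-persists lk p y<z)

  insertBeforeValley-at-valley : Peakless (x ∷ w) → All (x <_) w → insertBeforeValley x w ≡ x ∷ w
  insertBeforeValley-at-valley {w = []}        _        _         = refl
  insertBeforeValley-at-valley {w = _ ∷ []}    _        _         = refl
  insertBeforeValley-at-valley {w = a ∷ b ∷ w} (np ∷ _) (x<a ∷ _) with b <? a
  ... | yes b<a = ⊥-elim (np (x<a , b<a))
  ... | no  _   = refl

  min-next-to-valley : ∀ u → Linked _≢_ (u ++ x ∷ v) → Peakless (u ++ x ∷ v) → All (x <_) (u ++ v) →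
                  insertBeforeValley x (u ++ v) ≡ u ++ x ∷ v ⊎ insertAfterValley x (u ++ v) ≡ u ++ x ∷ v
  min-next-to-valley [] _ p x<v = inj₁ (insertBeforeValley-at-valley p x<v)
  min-next-to-valley {v = []}    (a ∷ []) _ _ _ = inj₂ refl
  min-next-to-valley {v = b ∷ v} (a ∷ []) _ (_ ∷ p) (_ ∷ x<bv) with b <? a
  ... | yes _ = inj₁ (cong (a ∷_) (insertBeforeValley-at-valley p x<bv))
  ... | no  _ = inj₂ refl
  min-next-to-valley (a ∷ u@(a′ ∷ u′)) (a≢a′ ∷ lk) p@(_ ∷ p′) (_ ∷ x<u++v)
    with a′ <? a | min-next-to-valley u lk p′ x<u++v
  ... | yes _    | ih = Sum.map (cong (a ∷_)) (cong (a ∷_)) ih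
  ... | no  a′≮a | _  =
    let a′<x = All.lookup (ascent-persists lk p (≢∧≯⇒< a≢a′ a′≮a)) (∈-insert u′)
    in ⊥-elim (asym a′<x (All.lookup x<u++v (here refl)))

Covers : ℕ → List ℤ → Set
Covers n w = ∀ {k} → k < n → ∃[ x ] x ∈ w × ∣ x ∣ ≡ suc k

record IsSignedPerm (n : ℕ) (w : List ℤ) : Set where
  field
    length≡ : length w ≡ n
    nonzero : ∀ {x} → x ∈ w → NonZero ∣ x ∣
    bounded : ∀ {x} → x ∈ w → ∣ x ∣ ≤ n
    covers  : Covers n w

open IsSignedPerm

private variable
  m n : ℕ
  x y : ℤ
  w w′ : List ℤ

isSignedPerm⇔ : T (isSignedPerm n w) ⇔ IsSignedPerm n w
isSignedPerm⇔ {n} {w} = mk⇔ to from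
  where
    ∧⁻ : ∀ {a b} → T (a ∧ b) → T a × T b
    ∧⁻ = Equivalence.to T-∧
    ∧⁺ : ∀ {a b} → T a × T b → T (a ∧ b)
    ∧⁺ = Equivalence.from T-∧

    to : T (isSignedPerm n w) → IsSignedPerm n w
    to t = record
      { length≡ = ℕP.≡ᵇ⇒≡ (length w) n len
      ; nonzero = λ x∈w → record { nonZero = proj₁ (letter x∈w) }
      ; bounded = λ x∈w → ℕP.≤ᵇ⇒≤ _ n (proj₂ (letter x∈w))
      ; covers  = λ k<n →
          let x , x∈w , eq = find (any⁻ _ w (All.lookup (all⁺ _ (upTo n) cov) (∈-upTo⁺ k<n)))
          in x , x∈w , ℕP.≡ᵇ⇒≡ _ _ eq
      }
      where
        parts : T (length w ℕ.≡ᵇ n) × T (all (letterOK n) w) × T (coversAll n w)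
        parts = Product.map₂ ∧⁻ (∧⁻ t)
        len = proj₁ parts
        cov = proj₂ (proj₂ parts)
        letter : x ∈ w → T (not (∣ x ∣ ℕ.≡ᵇ 0)) × T (∣ x ∣ ℕ.≤ᵇ n)
        letter x∈w = ∧⁻ (All.lookup (all⁺ (letterOK n) w (proj₁ (proj₂ parts))) x∈w)

    from : IsSignedPerm n w → T (isSignedPerm n w)
    from σ = ∧⁺ (ℕP.≡⇒≡ᵇ _ _ (length≡ σ) , ∧⁺ (all⁻ (letterOK n) letters , all⁻ _ cov))
      where
        letters : All (T ∘ letterOK n) w
        letters = All.tabulate λ x∈w →
          ∧⁺ (NonZero.nonZero (nonzero σ x∈w) , ℕP.≤⇒≤ᵇ (bounded σ x∈w))
        cov : All (λ k → T (any (λ x → ∣ x ∣ ℕ.≡ᵇ suc k) w)) (upTo n)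
        cov = All.tabulate λ k∈upTo →
          let x , x∈w , eq = covers σ (∈-upTo⁻ k∈upTo)
          in any⁺ _ (lose x∈w (ℕP.≡⇒≡ᵇ _ _ eq))

covers-resp-↭ : w ↭ w′ → Covers n w → Covers n w′
covers-resp-↭ w↭w′ cov k<n = let x , x∈w , eq = cov k<n in x , ∈-resp-↭ w↭w′ x∈w , eq

covers-∷⁻ : ∣ x ∣ ≡ suc n → Covers (suc n) (x ∷ w) → Covers n w
covers-∷⁻ ∣x∣≡ cov k<n with cov (ℕP.m<n⇒m<1+n k<n)
... | _ , here refl   , ∣x∣≡1+k = ⊥-elim (ℕP.<-irrefl (ℕP.suc-injective (trans (sym ∣x∣≡1+k) ∣x∣≡)) k<n)
... | y , there y∈w   , ∣y∣≡1+k = y , y∈w , ∣y∣≡1+k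

∈⇒↭∷ : x ∈ w → ∃[ w′ ] w ↭ x ∷ w′
∈⇒↭∷ {x} x∈w = let u , v , w≡ = ∈-∃++ x∈w in u ++ v , subst (_↭ x ∷ u ++ v) (sym w≡) (shift x u v)

covers-length : Covers n w → n ≤ length w
covers-length {zero}  _   = z≤n
covers-length {suc n} cov =
  let x , x∈w , ∣x∣≡ = cov (ℕP.n<1+n n)
      w′ , w↭x∷w′    = ∈⇒↭∷ x∈w
  in subst (suc n ≤_) (sym (↭-length w↭x∷w′))
       (s≤s (covers-length (covers-∷⁻ ∣x∣≡ (covers-resp-↭ w↭x∷w′ cov))))

IsSignedPerm-resp-↭ : w ↭ w′ → IsSignedPerm n w → IsSignedPerm n w′
IsSignedPerm-resp-↭ w↭w′ σ = record
  { length≡ = trans (sym (↭-length w↭w′)) (length≡ σ)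
  ; nonzero = nonzero σ ∘ ∈-resp-↭ (↭-sym w↭w′)
  ; bounded = bounded σ ∘ ∈-resp-↭ (↭-sym w↭w′)
  ; covers  = covers-resp-↭ w↭w′ (covers σ)
  }

-- Pigeonhole: if ∣ y ∣ ≡ ∣ x ∣, the n - 1 letters of w alone cover all n values.
abs-distinct : IsSignedPerm n (x ∷ w) → y ∈ w → ∣ y ∣ ≢ ∣ x ∣
abs-distinct {n} {w = w} σ y∈w ∣y∣≡∣x∣ =
  ℕP.1+n≰n (subst (_≤ length w) (sym (length≡ σ)) (covers-length covers′))
  where
    covers′ : Covers n w
    covers′ k<n with covers σ k<n
    ... | _ , here refl , eq = _ , y∈w , trans ∣y∣≡∣x∣ eq
    ... | z , there z∈w , eq = z , z∈w , eq

IsSignedPerm-∷⁺ : ∣ x ∣ ≡ suc m → IsSignedPerm m w → IsSignedPerm (suc m) (x ∷ w)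
IsSignedPerm-∷⁺ {x} {m} ∣x∣≡ σ = record
  { length≡ = cong suc (length≡ σ)
  ; nonzero = λ { (here refl) → subst NonZero (sym ∣x∣≡) _ ; (there y∈w) → nonzero σ y∈w }
  ; bounded = λ { (here refl) → ℕP.≤-reflexive ∣x∣≡ ; (there y∈w) → ℕP.m≤n⇒m≤1+n (bounded σ y∈w) }
  ; covers  = covers′
  }
  where
    covers′ : Covers (suc m) (x ∷ _)
    covers′ {k} k<1+m with k ℕ.≟ m
    ... | yes refl = x , here refl , ∣x∣≡
    ... | no  k≢m  = let y , y∈w , eq = covers σ (ℕP.≤∧≢⇒< (ℕP.≤-pred k<1+m) k≢m)
                     in y , there y∈w , eq

IsSignedPerm-∷⁻ : ∣ x ∣ ≡ suc m → IsSignedPerm (suc m) (x ∷ w) → IsSignedPerm m w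
IsSignedPerm-∷⁻ ∣x∣≡ σ = record
  { length≡ = ℕP.suc-injective (length≡ σ)
  ; nonzero = nonzero σ ∘ there
  ; bounded = λ y∈w → ℕP.≤-pred (ℕP.≤∧≢⇒< (bounded σ (there y∈w))
                                 (λ eq → abs-distinct σ y∈w (trans eq (sym ∣x∣≡))))
  ; covers  = covers-∷⁻ ∣x∣≡ (covers σ)
  }

adjacent-distinct : IsSignedPerm n w → Linked _≢_ w
adjacent-distinct {n} = go []
  where
    go : ∀ u {w} → IsSignedPerm n (u ++ w) → Linked _≢_ w
    go u {[]}        _ = []
    go u {x ∷ []}    _ = [-]
    go u {x ∷ y ∷ w} σ =
      (λ x≡y → abs-distinct (IsSignedPerm-resp-↭ (shift x u (y ∷ w)) σ) (∈-insert u) (cong ∣_∣ (sym x≡y)))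
      ∷ go (u ∷ʳ x) (subst (IsSignedPerm n) (sym (++-assoc u [ x ] (y ∷ w))) σ)

open PeaklessWords ℤP.<-isStrictTotalOrder

peakless⇔ : T (not (hasPeak w)) ⇔ Peakless w
peakless⇔ = mk⇔ (to _) (from _)
  where
    to : ∀ w → T (not (hasPeak w)) → Peakless w
    to []              _ = []
    to (_ ∷ [])        _ = _ ∷ []
    to (_ ∷ _ ∷ [])    _ = _ ∷ _ ∷ []
    to (a ∷ b ∷ c ∷ w) t with a ℤP.<? b | c ℤP.<? b | to (b ∷ c ∷ w)
    ... | yes _   | yes _   | _  = ⊥-elim t
    ... | yes _   | no  c≮b | ih = (c≮b ∘ proj₂) ∷ ih t
    ... | no  a≮b | _       | ih = (a≮b ∘ proj₁) ∷ ih t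

    from : ∀ w → Peakless w → T (not (hasPeak w))
    from []              _ = _
    from (_ ∷ [])        _ = _
    from (_ ∷ _ ∷ [])    _ = _
    from (a ∷ b ∷ c ∷ w) (np ∷ p) with a ℤP.<? b | c ℤP.<? b | from (b ∷ c ∷ w) p
    ... | yes a<b | yes c<b | _  = np (a<b , c<b)
    ... | yes _   | no  _   | ih = ih
    ... | no  _   | _       | ih = ih

word : PB∅ n → List ℤ
word = proj₁ ∘ proj₁

PB∅-≡ : {π π′ : PB∅ n} → word π ≡ word π′ → π ≡ π′
PB∅-≡ {π = (w , s) , p} {(_ , s′) , p′} refl =
  cong₂ (λ s p → (w , s) , p) (T-irrelevant s s′) (T-irrelevant p p′)

PB∅-isSignedPerm : (π : PB∅ n) → IsSignedPerm n (word π)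
PB∅-isSignedPerm ((_ , s) , _) = Equivalence.to isSignedPerm⇔ s

PB∅-peakless : (π : PB∅ n) → Peakless (word π)
PB∅-peakless (_ , p) = Equivalence.to peakless⇔ p

toPB∅ : IsSignedPerm n w → Peakless w → PB∅ n
toPB∅ {w = w} σ p = (w , Equivalence.from isSignedPerm⇔ σ) , Equivalence.from peakless⇔ p

nonempty : IsSignedPerm (suc n) w → w ≢ []
nonempty σ refl with length≡ σ
... | ()

data Side : Set where
  left right : Side

Placement : Set
Placement = Sign × Side

module NewLetter (m : ℕ) where

  newLetter : Sign → ℤ
  newLetter Sign.+ = + suc m
  newLetter Sign.- = -[1+ m ]

  ∣newLetter∣ : ∀ s → ∣ newLetter s ∣ ≡ suc m
  ∣newLetter∣ Sign.+ = refl
  ∣newLetter∣ Sign.- = refl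

  newLetter-injective : ∀ {s s′} → newLetter s ≡ newLetter s′ → s ≡ s′
  newLetter-injective {Sign.+} {Sign.+} _ = refl
  newLetter-injective {Sign.-} {Sign.-} _ = refl

  ∣y∣≡1+m⇒newLetter : ∣ y ∣ ≡ suc m → ∃[ s ] y ≡ newLetter s
  ∣y∣≡1+m⇒newLetter {+ _}      refl = Sign.+ , refl
  ∣y∣≡1+m⇒newLetter { -[1+ _ ]} refl = Sign.- , refl

  ∣letter∣≢1+m : IsSignedPerm m w → y ∈ w → ∣ y ∣ ≢ suc m
  ∣letter∣≢1+m σ y∈w ∣y∣≡ = ℕP.1+n≰n (subst (_≤ m) ∣y∣≡ (bounded σ y∈w))

  newLetter∉ : ∀ {s} → IsSignedPerm m w → newLetter s ∉ w
  newLetter∉ {s = s} σ s∈w = ∣letter∣≢1+m σ s∈w (∣newLetter∣ s)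

  below-newMax : IsSignedPerm m w → All (ℤ._< newLetter Sign.+) w
  below-newMax σ = All.tabulate (∣y∣≤m⇒y<+[1+m] ∘ bounded σ)
    where
      ∣y∣≤m⇒y<+[1+m] : ∣ y ∣ ≤ m → y ℤ.< + suc m
      ∣y∣≤m⇒y<+[1+m] {+ _}       ∣y∣≤m = +<+ (s≤s ∣y∣≤m)
      ∣y∣≤m⇒y<+[1+m] { -[1+ _ ]} _     = -<+

  above-newMin : IsSignedPerm m w → All (newLetter Sign.- ℤ.<_) w
  above-newMin σ = All.tabulate (∣y∣≤m⇒-[1+m]<y ∘ bounded σ)
    where
      ∣y∣≤m⇒-[1+m]<y : ∣ y ∣ ≤ m → -[1+ m ] ℤ.< y
      ∣y∣≤m⇒-[1+m]<y {+ _}       _     = -<+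
      ∣y∣≤m⇒-[1+m]<y { -[1+ _ ]} ∣y∣≤m = -<- ∣y∣≤m

  place : Placement → List ℤ → List ℤ
  place (Sign.+ , left)  w = newLetter Sign.+ ∷ w
  place (Sign.+ , right) w = w ∷ʳ newLetter Sign.+
  place (Sign.- , left)  w = insertBeforeValley (newLetter Sign.-) w
  place (Sign.- , right) w = insertAfterValley (newLetter Sign.-) w

  place-split : ∀ p w → ∃₂ λ u v → w ≡ u ++ v × place p w ≡ u ++ newLetter (proj₁ p) ∷ v
  place-split (Sign.+ , left)  w = [] , w , refl , refl
  place-split (Sign.+ , right) w = w , [] , sym (++-identityʳ w) , refl
  place-split (Sign.- , left)  w = insertBeforeValley-split _ w
  place-split (Sign.- , right) w = insertAfterValley-split _ w

  place-isSignedPerm : ∀ p → IsSignedPerm m w → IsSignedPerm (suc m) (place p w)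
  place-isSignedPerm {w} p σ =
    let u , v , w≡ , place≡ = place-split p w
    in subst (IsSignedPerm (suc m)) (sym place≡)
         (IsSignedPerm-resp-↭ (↭-sym (shift _ u v))
           (IsSignedPerm-∷⁺ (∣newLetter∣ (proj₁ p)) (subst (IsSignedPerm m) w≡ σ)))

  place-peakless : ∀ p → IsSignedPerm m w → Peakless w → Peakless (place p w)
  place-peakless (Sign.+ , left)  σ pw = peakless-∷⁺ (All⇒HeadBelow (below-newMax σ)) pw
  place-peakless (Sign.+ , right) σ pw = peakless-∷ʳ⁺ (below-newMax σ) pw
  place-peakless (Sign.- , left)  σ pw = peakless-insertBeforeValley (above-newMin σ) pw
  place-peakless (Sign.- , right) σ pw =
    peakless-insertAfterValley (above-newMin σ) (adjacent-distinct σ) pw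

  old? : U.Decidable (λ y → ∣ y ∣ ≢ suc m)
  old? y = ¬? (∣ y ∣ ℕ.≟ suc m)

  filter-old?-place : ∀ p → IsSignedPerm m w → filter old? (place p w) ≡ w
  filter-old?-place {w} p σ =
    let u , v , w≡ , place≡ = place-split p w
        old-u , old-v = All.++⁻ u (subst (All _) w≡ (All.tabulate (∣letter∣≢1+m σ)))
    in begin
      filter old? (place p w)                          ≡⟨ cong (filter old?) place≡ ⟩
      filter old? (u ++ newLetter (proj₁ p) ∷ v)       ≡⟨ filter-++ old? u (newLetter (proj₁ p) ∷ v) ⟩
      filter old? u ++ filter old? (newLetter (proj₁ p) ∷ v)
        ≡⟨ cong (filter old? u ++_)
                (filter-reject old? {x = newLetter (proj₁ p)} {xs = v} (λ old → old (∣newLetter∣ (proj₁ p)))) ⟩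
      filter old? u ++ filter old? v                   ≡⟨ cong₂ _++_ (filter-all old? old-u) (filter-all old? old-v) ⟩
      u ++ v                                           ≡⟨ sym w≡ ⟩
      w                                                ∎
    where open ≡-Reasoning

  ∈-place : ∀ p → IsSignedPerm m w → y ∈ place p w → ∣ y ∣ ≡ suc m → y ≡ newLetter (proj₁ p)
  ∈-place {w} p σ y∈ ∣y∣≡ with place-split p w
  ... | u , v , refl , place≡ with ∈-resp-↭ (shift _ u v) (subst (_ ∈_) place≡ y∈)
  ...   | here y≡new  = y≡new
  ...   | there y∈u++v = ⊥-elim (∣letter∣≢1+m σ y∈u++v ∣y∣≡)

  sign-determined : ∀ {s s′ d d′} → IsSignedPerm m w → place (s , d) w ≡ place (s′ , d′) w → s ≡ s′
  sign-determined {w} {s} {s′} {d} {d′} σ eq =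
    let u , v , _ , place≡ = place-split (s , d) w
        new∈ = subst (newLetter s ∈_) (trans (sym place≡) eq) (∈-insert u)
    in newLetter-injective (∈-place (s′ , d′) σ new∈ (∣newLetter∣ s))

  side-determined : ∀ {s d d′} → IsSignedPerm m w → w ≢ [] → place (s , d) w ≡ place (s , d′) w → d ≡ d′
  side-determined {d = left}  {left}  _ _ _ = refl
  side-determined {d = right} {right} _ _ _ = refl
  side-determined {[]}    {Sign.+} {left}  {right} _ w≢[] _  = ⊥-elim (w≢[] refl)
  side-determined {_ ∷ _} {Sign.+} {left}  {right} σ _    eq = ⊥-elim (newLetter∉ σ (here (∷-injectiveˡ eq)))
  side-determined {[]}    {Sign.+} {right} {left}  _ w≢[] _  = ⊥-elim (w≢[] refl)
  side-determined {_ ∷ _} {Sign.+} {right} {left}  σ _    eq = ⊥-elim (newLetter∉ σ (here (∷-injectiveˡ (sym eq))))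
  side-determined {s = Sign.-} {left}  {right} σ w≢[] eq =
    ⊥-elim (insertBeforeValley≢insertAfterValley (newLetter∉ σ) w≢[] eq)
  side-determined {s = Sign.-} {right} {left}  σ w≢[] eq =
    ⊥-elim (insertBeforeValley≢insertAfterValley (newLetter∉ σ) w≢[] (sym eq))

  place-injective : ∀ {p p′} → IsSignedPerm m w → IsSignedPerm m w′ → w ≢ [] →
                    place p w ≡ place p′ w′ → p ≡ p′ × w ≡ w′
  place-injective {p = s , d} {s′ , d′} σ σ′ w≢[] eq
    with refl ← trans (sym (filter-old?-place (s , d) σ))
                  (trans (cong (filter old?) eq) (filter-old?-place (s′ , d′) σ′))
    with refl ← sign-determined {s = s} {s′} {d} {d′} σ eq
    = cong (s ,_) (side-determined {s = s} {d} {d′} σ w≢[] eq) , refl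

  decompose : IsSignedPerm (suc m) w → Peakless w →
              ∃₂ λ p w′ → IsSignedPerm m w′ × Peakless w′ × place p w′ ≡ w
  decompose σ pw with covers σ (ℕP.n<1+n m)
  ... | x , x∈w , ∣x∣≡ with ∈-∃++ x∈w
  ... | u , v , refl
    with IsSignedPerm-∷⁻ ∣x∣≡ (IsSignedPerm-resp-↭ (shift x u v) σ) | ∣y∣≡1+m⇒newLetter {x} ∣x∣≡
  ... | σ′ | Sign.+ , refl with max-at-end u pw (below-newMax σ′)
  ...   | inj₁ refl = (Sign.+ , left) , v , σ′ , peakless-∷⁻ pw , refl
  ...   | inj₂ refl = (Sign.+ , right) , u , subst (IsSignedPerm m) (++-identityʳ u) σ′ ,
                      peakless-∷ʳ⁻ u pw , refl
  decompose σ pw | _ | u , v , refl | σ′ | Sign.- , refl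
    with min-next-to-valley u (adjacent-distinct σ) pw (above-newMin σ′)
  ... | inj₁ place≡ = (Sign.- , left)  , u ++ v , σ′ , peakless-remove-min u pw (above-newMin σ′) , place≡
  ... | inj₂ place≡ = (Sign.- , right) , u ++ v , σ′ , peakless-remove-min u pw (above-newMin σ′) , place≡

PB∅-step : ∀ n → PB∅ (suc (suc n)) ↔ (Placement × PB∅ (suc n))
PB∅-step n = mk↔ₛ′ split join split∘join join∘split
  where
    open NewLetter (suc n)

    decomposeπ : (π : PB∅ (suc (suc n))) →
                 ∃₂ λ p w′ → IsSignedPerm (suc n) w′ × Peakless w′ × place p w′ ≡ word π
    decomposeπ π = decompose (PB∅-isSignedPerm π) (PB∅-peakless π)

    split : PB∅ (suc (suc n)) → Placement × PB∅ (suc n)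
    split π = let p , _ , σ′ , pw′ , _ = decomposeπ π in p , toPB∅ σ′ pw′

    join : Placement × PB∅ (suc n) → PB∅ (suc (suc n))
    join (p , π) = toPB∅ (place-isSignedPerm p σ) (place-peakless p σ (PB∅-peakless π))
      where σ = PB∅-isSignedPerm π

    split∘join : ∀ pπ → split (join pπ) ≡ pπ
    split∘join (p , π) =
      let _ , _ , σ′ , _ , place≡ = decomposeπ (join (p , π))
          p≡ , w≡ = place-injective σ′ (PB∅-isSignedPerm π) (nonempty σ′) place≡
      in cong₂ _,_ p≡ (PB∅-≡ w≡)

    join∘split : ∀ π → join (split π) ≡ π
    join∘split π = let _ , _ , _ , _ , place≡ = decomposeπ π in PB∅-≡ place≡

PB∅₁↔Sign : PB∅ 1 ↔ Sign
PB∅₁↔Sign = mk↔ₛ′ signOf singleton signOf∘singleton singleton∘signOf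
  where
    open NewLetter 0

    singleton-shape : IsSignedPerm 1 w → ∃[ s ] w ≡ [ newLetter s ]
    singleton-shape {[]}        σ with length≡ σ
    ... | ()
    singleton-shape {_ ∷ _ ∷ _} σ with length≡ σ
    ... | ()
    singleton-shape {x ∷ []}    σ with covers σ (ℕP.n<1+n 0)
    ... | _ , here refl , ∣x∣≡1 = Product.map₂ (cong [_]) (∣y∣≡1+m⇒newLetter {x} ∣x∣≡1)

    signOf : PB∅ 1 → Sign
    signOf π = proj₁ (singleton-shape (PB∅-isSignedPerm π))

    singleton : Sign → PB∅ 1
    singleton s = toPB∅ (IsSignedPerm-∷⁺ (∣newLetter∣ s) empty) (_ ∷ [])
      where
        empty : IsSignedPerm 0 []
        empty = record { length≡ = refl ; nonzero = λ () ; bounded = λ () ; covers = λ () }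

    signOf∘singleton : ∀ s → signOf (singleton s) ≡ s
    signOf∘singleton s =
      sym (newLetter-injective (∷-injectiveˡ (proj₂ (singleton-shape (PB∅-isSignedPerm (singleton s))))))

    singleton∘signOf : ∀ π → singleton (signOf π) ≡ π
    singleton∘signOf π = PB∅-≡ (sym (proj₂ (singleton-shape (PB∅-isSignedPerm π))))

Sign↔Fin2 : Sign ↔ Fin 2
Sign↔Fin2 = mk↔ₛ′ (λ { Sign.+ → 0F ; Sign.- → 1F }) (λ { 0F → Sign.+ ; 1F → Sign.- })
                  (λ { 0F → refl ; 1F → refl }) (λ { Sign.+ → refl ; Sign.- → refl })

Side↔Fin2 : Side ↔ Fin 2
Side↔Fin2 = mk↔ₛ′ (λ { left → 0F ; right → 1F }) (λ { 0F → left ; 1F → right })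
                  (λ { 0F → refl ; 1F → refl }) (λ { left → refl ; right → refl })

Placement↔Fin4 : Placement ↔ Fin 4
Placement↔Fin4 = ↔-trans (Sign↔Fin2 ×-↔ Side↔Fin2) (↔-sym *↔×)

2^[2n+3]≡4*2^[2n+1] : ∀ n → 2 ^ (2 * suc (suc n) ∸ 1) ≡ 4 * 2 ^ (2 * suc n ∸ 1)
2^[2n+3]≡4*2^[2n+1] n = begin
  2 ^ (2 * suc (suc n) ∸ 1)     ≡⟨ cong (λ k → 2 ^ (k ∸ 1)) (ℕP.*-suc 2 (suc n)) ⟩
  2 * (2 * 2 ^ (2 * suc n ∸ 1)) ≡⟨ ℕP.*-assoc 2 2 (2 ^ (2 * suc n ∸ 1)) ⟨
  4 * 2 ^ (2 * suc n ∸ 1)       ∎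
  where open ≡-Reasoning

PB∅↔Fin : ∀ n → PB∅ (suc n) ↔ Fin (2 ^ (2 * suc n ∸ 1))
PB∅↔Fin zero    = ↔-trans PB∅₁↔Sign Sign↔Fin2
PB∅↔Fin (suc n) rewrite 2^[2n+3]≡4*2^[2n+1] n =
  ↔-trans (PB∅-step n) (↔-trans (Placement↔Fin4 ×-↔ PB∅↔Fin n) (↔-sym *↔×))

proposition2p3 : (n : ℕ) → 1 Data.Nat.≤ n → PB∅ n ↔ Fin (2 ^ (2 * n ∸ 1))
proposition2p3 (suc n) _ = PB∅↔Fin n
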